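{- $\mathrm{ex}_<(n,P_5^{1324})=\Theta(n\log n)$.
   Context: Edge-ordered graph: finite simple graph with a linear order on its edges; isomorphisms preserve order; subgraphs carry induced order; $\mathrm{ex}_<(n,H)$ is the maximum number of edges of an edge-ordered graph on $n$ vertices with no subgraph isomorphic to $H$. Notation: $P_k^{a_1\dots a_{k-1}}$ is the path $v_1\dots v_k$ where edge $v_iv_{i+1}$ has label $a_i$ and edges are ordered by label. -}

module Defs where

open import Data.Nat using (ℕ; _<_; _≤_; _*_; suc)
open import Data.Nat.Logarithm using (⌊log₂_⌋)
open import Data.Fin using (Fin; toℕ)
open import Data.List using (List; length; lookup)
open import Data.List.Relation.Unary.All using (All)
open import Data.List.Relation.Unary.AllPairs using (AllPairs)
open import Data.Product using (Σ; _×_; _,_; ∃-syntax)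
open import Data.Sum using (_⊎_)
open import Relation.Binary.PropositionalEquality using (_≡_; _≢_)
open import Relation.Nullary using (¬_)

-- An edge-ordered simple graph on vertex set Fin n.
-- The edges are listed as pairs (u , v) with u < v (so no loops, and each
-- unordered edge has a unique representation), pairwise distinct (no multi-edges).
-- The linear order on the edges is the order of the list: earlier = smaller.
record EOGraph (n : ℕ) : Set where
  constructor mkEOGraph
  field
    edges    : List (Fin n × Fin n)
    oriented : All (λ e → toℕ (Data.Product.proj₁ e) < toℕ (Data.Product.proj₂ e)) edges
    distinct : AllPairs _≢_ edges
open EOGraph public

∣E∣ : ∀ {n} → EOGraph n → ℕ
∣E∣ G = length (edges G)

Pos : ∀ {n} → EOGraph n → Set
Pos G = Fin (length (edges G))

Joins : ∀ {n} (G : EOGraph n) → Pos G → Fin n → Fin n → Set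
Joins G k u v = (lookup (edges G) k ≡ (u , v)) ⊎ (lookup (edges G) k ≡ (v , u))

-- G contains a subgraph isomorphic (as edge-ordered graph) to P_5^{1324}:
-- distinct vertices v1..v5 and edges e1 = v1v2, e2 = v2v3, e3 = v3v4, e4 = v4v5
-- whose induced order is e1 < e3 < e2 < e4 (labels 1,3,2,4).
ContainsP5-1324 : ∀ {n} → EOGraph n → Set
ContainsP5-1324 {n} G =
  Σ (Fin n) λ v1 → Σ (Fin n) λ v2 → Σ (Fin n) λ v3 → Σ (Fin n) λ v4 → Σ (Fin n) λ v5 →
    (v1 ≢ v2) × (v1 ≢ v3) × (v1 ≢ v4) × (v1 ≢ v5) × (v2 ≢ v3) ×
    (v2 ≢ v4) × (v2 ≢ v5) × (v3 ≢ v4) × (v3 ≢ v5) × (v4 ≢ v5) ×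
    Σ (Pos G) λ e1 → Σ (Pos G) λ e2 → Σ (Pos G) λ e3 → Σ (Pos G) λ e4 →
      Joins G e1 v1 v2 × Joins G e2 v2 v3 × Joins G e3 v3 v4 × Joins G e4 v4 v5 ×
      (toℕ e1 < toℕ e3) × (toℕ e3 < toℕ e2) × (toℕ e2 < toℕ e4)

{-# OPTIONS --safe #-}
module Submission where

-- Upper bound. Suppose that edges f < g share the endpoint v₃ = w, with other endpoints v₄ ∈ f and v₂ ∈ g. If v₂ has
-- an edge before f and v₄ has an edge after g, they complete a P₅^{1324}, up to coincidences of vertices that are avoided
-- by having three edges to choose from. So when f and g are less than d apart, it is impossible that both endpoints of
-- f and of g have three edges at distance ≥ d on either side. For each edge take the largest scale d = 2ᵏ at which both
-- of its endpoints have this property; it fails at 2d for some endpoint w on some side. The edges with the same w, side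
-- and k lie in a window of length 2ᵏ, since they are at distance between 2ᵏ and 2ᵏ⁺¹ from the third (first or last)
-- edge of w; hence there is at most one of them. That leaves O(log n) edges to be charged to each vertex.
--
-- Lower bound. Join a low vertex x to the high vertex y = x + 2ᵏ (shifted by m), and order the edges by x + y.
-- At a low v₃ = x with v₄ = x + 2ⁱ, v₂ = x + 2ʲ and i < j, every other edge at v₄ has a sum below 2x + 2·2ⁱ ≤ 2x + 2ʲ, so it
-- precedes the edge v₂v₃; at a high v₃, dually, every edge at v₂ comes after the edge v₃v₄.

open import Defs
open import Data.Nat using (ℕ; _≤_; _*_)
open import Data.Nat.Logarithm using (⌊log₂_⌋)
open import Data.Product using (Σ; _×_)
open import Relation.Nullary using (¬_)

open import Data.Nat using (zero; suc; _+_; _^_; _∸_; _<_; _≤?_; _<?_; z≤n; s≤s; ⌊_/2⌋)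
open import Data.Nat.Properties
open import Data.Nat.Logarithm using (⌊log₂⌋-mono-≤; ⌊log₂⌊n/2⌋⌋≡⌊log₂n⌋∸1; ⌊log₂[2^n]⌋≡n)
open import Data.Nat.Tactic.RingSolver using (solve-∀)
open import Data.Empty using (⊥; ⊥-elim)
open import Data.Fin as Fin using (Fin; toℕ; fromℕ<; combine; remQuot)
open import Data.Fin.Patterns using (0F; 1F)
open import Data.Fin.Properties as Fin using (any?; all?; ¬∀⟶∃¬; toℕ-injective; toℕ<n; toℕ-fromℕ<; fromℕ<-injective; combine-injective; combine-remQuot; injective⇒≤)
open import Data.List using (List; lookup; tabulate)
open import Data.List.Membership.Propositional.Properties using (∈-lookup)
open import Data.List.Properties using (length-tabulate)
open import Data.List.Relation.Binary.Permutation.Propositional using (↭-sym; ↭⇒↭ₛ)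
open import Data.List.Relation.Binary.Permutation.Propositional.Properties using (↭-length; All-resp-↭)
import Data.List.Relation.Binary.Permutation.Setoid.Properties as Permutationₛ
open import Data.List.Relation.Unary.All as All using (All)
import Data.List.Relation.Unary.All.Properties as All
open import Data.List.Relation.Unary.AllPairs using (AllPairs; _∷_)
open import Data.List.Relation.Unary.Sorted.TotalOrder.Properties using (lookup-mono-≤)
import Data.List.Relation.Unary.Unique.Propositional.Properties as Unique
import Data.List.Sort as Sort
open import Data.Product using (_,_; proj₁; proj₂; ∃-syntax; uncurry)
open import Data.Sum as Sum using (_⊎_; inj₁; inj₂)
open import Data.Unit using (⊤; tt)
open import Function using (_∘_)
open import Relation.Binary.Bundles using (DecTotalOrder)
import Relation.Binary.Construct.On as On
open import Relation.Binary.Definitions using (tri<; tri≈; tri>)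
open import Relation.Binary.PropositionalEquality using (_≡_; _≢_; refl; sym; trans; cong; cong₂; subst; subst₂; setoid)
open import Relation.Nullary using (Dec; yes; no)
open import Relation.Nullary.Decidable using (_×-dec_; _⊎-dec_; _→-dec_)

-- Lists, search and cancellation

lookup-unique : ∀ {A : Set} {xs : List A} → AllPairs _≢_ xs →
  ∀ i j → lookup xs i ≡ lookup xs j → i ≡ j
lookup-unique (_  ∷ _)  Fin.zero    Fin.zero    _  = refl
lookup-unique (x≢ ∷ _)  Fin.zero    (Fin.suc j) eq = ⊥-elim (All.lookup x≢ (∈-lookup j) eq)
lookup-unique (x≢ ∷ _)  (Fin.suc i) Fin.zero    eq = ⊥-elim (All.lookup x≢ (∈-lookup i) (sym eq))
lookup-unique (_  ∷ xs) (Fin.suc i) (Fin.suc j) eq = cong Fin.suc (lookup-unique xs i j eq)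

-- Scanning down from `N` finds it. This selects the level at which an edge is charged.
last-true : ∀ {P : ℕ → Set} → (∀ i → Dec (P i)) → P 0 → ∀ N → ¬ P N →
  ∃[ i ] i < N × P i × ¬ P (suc i)
last-true P? p₀ zero    ¬p = ⊥-elim (¬p p₀)
last-true P? p₀ (suc N) ¬p with P? N
... | yes p  = N , ≤-refl , p , ¬p
... | no ¬p′ with last-true P? p₀ N ¬p′
...   | i , i<N , r = i , m≤n⇒m≤1+n i<N , r

cancel-shift : ∀ {x y p q} m → x + m + p ≡ y + m + q → x + p ≡ y + q
cancel-shift {x} {y} {p} {q} m eq = +-cancelˡ-≡ m _ _ (trans (sym (shift x m p)) (trans eq (shift y m q)))
  where
  shift : ∀ a b c → a + b + c ≡ b + (a + c)
  shift = solve-∀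

a+2b≡a+b+b : ∀ a b → a + 2 * b ≡ a + b + b
a+2b≡a+b+b = solve-∀

-- The upper bound

module UpperBound {n} (G : EOGraph n) where

  ends : Pos G → Fin n × Fin n
  ends = lookup (edges G)

  _∋_ : Pos G → Fin n → Set
  p ∋ w = proj₁ (ends p) ≡ w ⊎ proj₂ (ends p) ≡ w

  _∋?_ : ∀ p w → Dec (p ∋ w)
  p ∋? w = (proj₁ (ends p) Fin.≟ w) ⊎-dec (proj₂ (ends p) Fin.≟ w)

  other-end : ∀ {p w} → p ∋ w → ∃[ v ] Joins G p w v
  other-end {p} (inj₁ refl) = proj₂ (ends p) , inj₁ refl
  other-end {p} (inj₂ refl) = proj₁ (ends p) , inj₂ refl

  Joins-∋ʳ : ∀ {p u v} → Joins G p u v → p ∋ v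
  Joins-∋ʳ (inj₁ eq) = inj₂ (cong proj₂ eq)
  Joins-∋ʳ (inj₂ eq) = inj₁ (cong proj₁ eq)

  Joins-sym : ∀ {p u v} → Joins G p u v → Joins G p v u
  Joins-sym = Sum.swap

  ends-< : ∀ {p u v} → ends p ≡ (u , v) → toℕ u < toℕ v
  ends-< {p} eq = subst (λ e → toℕ (proj₁ e) < toℕ (proj₂ e)) eq (All.lookup (oriented G) (∈-lookup p))

  Joins-≢ : ∀ {p u v} → Joins G p u v → u ≢ v
  Joins-≢ {p} (inj₁ eq) refl = <-irrefl refl (ends-< {p} eq)
  Joins-≢ {p} (inj₂ eq) refl = <-irrefl refl (ends-< {p} eq)

  Joins-unique : ∀ {p q u v} → Joins G p u v → Joins G q u v → p ≡ q
  Joins-unique {p} {q} (inj₁ a) (inj₁ b) = lookup-unique (distinct G) p q (trans a (sym b))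
  Joins-unique {p} {q} (inj₂ a) (inj₂ b) = lookup-unique (distinct G) p q (trans a (sym b))
  Joins-unique {p} {q} (inj₁ a) (inj₂ b) = ⊥-elim (<-asym (ends-< {p} a) (ends-< {q} b))
  Joins-unique {p} {q} (inj₂ a) (inj₁ b) = ⊥-elim (<-asym (ends-< {p} a) (ends-< {q} b))

  -- Side 0F looks at earlier edges, side 1F at later ones.
  Ahead : Fin 2 → ℕ → Pos G → Pos G → Set
  Ahead 0F d q p = toℕ q + d ≤ toℕ p
  Ahead 1F d q p = toℕ p + d ≤ toℕ q

  Ahead? : ∀ s d q p → Dec (Ahead s d q p)
  Ahead? 0F d q p = toℕ q + d ≤? toℕ p
  Ahead? 1F d q p = toℕ p + d ≤? toℕ q

  -- Nested steps away from `p`: the gap `1` after the first step makes the edges distinct, and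
  -- putting one more edge in front is a mere pairing.
  Chain : Fin 2 → Fin n → ℕ → ℕ → Pos G → Set
  Chain s w zero    d p = ⊤
  Chain s w (suc j) d p = ∃[ q ] q ∋ w × Ahead s d q p × Chain s w j 1 q

  Chain? : ∀ s w j d p → Dec (Chain s w j d p)
  Chain? s w zero    d p = yes tt
  Chain? s w (suc j) d p = any? λ q → (q ∋? w) ×-dec Ahead? s d q p ×-dec Chain? s w j 1 q

  -- Levels 0–2 separate the first (last) three edges of w by their rank; level 3 + k is the scale 2ᵏ.
  Level : Fin 2 → Fin n → ℕ → Pos G → Set
  Level s w 0 p = Chain s w 0 1 p
  Level s w 1 p = Chain s w 1 1 p
  Level s w 2 p = Chain s w 2 1 p
  Level s w (suc (suc (suc k))) p = Chain s w 3 (2 ^ k) p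

  Level? : ∀ s w i p → Dec (Level s w i p)
  Level? s w 0 p = Chain? s w 0 1 p
  Level? s w 1 p = Chain? s w 1 1 p
  Level? s w 2 p = Chain? s w 2 1 p
  Level? s w (suc (suc (suc k))) p = Chain? s w 3 (2 ^ k) p

  Deep : ℕ → Pos G → Set
  Deep i p = ∀ w → p ∋ w → ∀ s → Level s w i p

  Deep? : ∀ i p → Dec (Deep i p)
  Deep? i p = all? λ w → (p ∋? w) →-dec all? λ s → Level? s w i p

  -- In a simple graph the three edges have different other ends, so `a` and `b` rule out at most
  -- two. Naming `t` among the three lets bounds on its position be recovered.
  avoid₂ : ∀ {p q r w} → p ∋ w → q ∋ w → r ∋ w → p ≢ q → p ≢ r → q ≢ r → ∀ a b →
    ∃[ t ] ∃[ v ] (t ≡ p ⊎ t ≡ q ⊎ t ≡ r) × Joins G t w v × v ≢ a × v ≢ b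
  avoid₂ {p} {q} {r} p∋ q∋ r∋ p≢q p≢r q≢r a b
    with other-end {p} p∋ | other-end {q} q∋ | other-end {r} r∋
  ... | x , jx | y , jy | z , jz = pick
    where
    differ : ∀ {p q w x y c} → Joins G p w x → Joins G q w y → p ≢ q → x ≡ c → y ≢ c
    differ {p} {q} jx jy p≢q refl refl = p≢q (Joins-unique {p} {q} jx jy)

    pick : _
    pick with x Fin.≟ a
    ... | yes x≡a with y Fin.≟ b
    ...   | yes y≡b = r , z , inj₂ (inj₂ refl) , jz , differ {p} {r} jx jz p≢r x≡a , differ {q} {r} jy jz q≢r y≡b
    ...   | no y≢b  = q , y , inj₂ (inj₁ refl) , jy , differ {p} {q} jx jy p≢q x≡a , y≢b
    pick | no x≢a with x Fin.≟ b
    ...   | no x≢b  = p , x , inj₁ refl , jx , x≢a , x≢b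
    ...   | yes x≡b with y Fin.≟ a
    ...     | yes y≡a = r , z , inj₂ (inj₂ refl) , jz , differ {q} {r} jy jz q≢r y≡a , differ {p} {r} jx jz p≢r x≡b
    ...     | no y≢a  = q , y , inj₂ (inj₁ refl) , jy , y≢a , differ {p} {q} jx jy p≢q x≡b

  <⇒≢ₚ : ∀ {p q : Pos G} → toℕ p < toℕ q → p ≢ q
  <⇒≢ₚ p<q refl = <-irrefl refl p<q

  +1≤⇒< : ∀ {a b} → a + 1 ≤ b → a < b
  +1≤⇒< {a} {b} = subst (_≤ b) (+-comm a 1)

  <⇒+1≤ : ∀ {a b} → a < b → a + 1 ≤ b
  <⇒+1≤ {a} {b} = subst (_≤ b) (+-comm 1 a)

  -- A chain moves away from `p`, so the distance `d` of its first edge holds for all three.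
  earlier-edge : ∀ {p w d} → Chain 0F w 3 d p → ∀ a b →
    ∃[ t ] ∃[ v ] toℕ t + d ≤ toℕ p × Joins G t w v × v ≢ a × v ≢ b
  earlier-edge {d = d} (q₁ , q₁∋ , h₁ , q₂ , q₂∋ , h₂ , q₃ , q₃∋ , h₃ , _) a b
    with h₂′ ← +1≤⇒< h₂ | h₃′ ← +1≤⇒< h₃
    with avoid₂ {q₁} {q₂} {q₃} q₁∋ q₂∋ q₃∋ (<⇒≢ₚ h₂′ ∘ sym) (<⇒≢ₚ (<-trans h₃′ h₂′) ∘ sym) (<⇒≢ₚ h₃′ ∘ sym) a b
  ... | t , v , inj₁ refl , r = t , v , h₁ , r
  ... | t , v , inj₂ (inj₁ refl) , r = t , v , ≤-trans (+-monoˡ-≤ d (<⇒≤ h₂′)) h₁ , r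
  ... | t , v , inj₂ (inj₂ refl) , r = t , v , ≤-trans (+-monoˡ-≤ d (<⇒≤ (<-trans h₃′ h₂′))) h₁ , r

  later-edge : ∀ {p w d} → Chain 1F w 3 d p → ∀ a b →
    ∃[ t ] ∃[ v ] toℕ p + d ≤ toℕ t × Joins G t w v × v ≢ a × v ≢ b
  later-edge (q₁ , q₁∋ , h₁ , q₂ , q₂∋ , h₂ , q₃ , q₃∋ , h₃ , _) a b
    with h₂′ ← +1≤⇒< h₂ | h₃′ ← +1≤⇒< h₃
    with avoid₂ {q₁} {q₂} {q₃} q₁∋ q₂∋ q₃∋ (<⇒≢ₚ h₂′) (<⇒≢ₚ (<-trans h₂′ h₃′)) (<⇒≢ₚ h₃′) a b
  ... | t , v , inj₁ refl , r = t , v , h₁ , r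
  ... | t , v , inj₂ (inj₁ refl) , r = t , v , ≤-trans h₁ (<⇒≤ h₂′) , r
  ... | t , v , inj₂ (inj₂ refl) , r = t , v , ≤-trans h₁ (<⇒≤ (<-trans h₂′ h₃′)) , r

  -- The path is v₁ y w x v₅ with `g` = yw and `f` = wx. Going back `2 ^ k` from `g` passes `f`, and
  -- going forward `2 ^ k` from `f` passes `g`.
  close-deep⇒path : ∀ {w f g k} → f ∋ w → g ∋ w → toℕ f < toℕ g → toℕ g < toℕ f + 2 ^ k →
    Deep (3 + k) f → Deep (3 + k) g → ContainsP5-1324 G
  close-deep⇒path {w} {f} {g} {k} f∋ g∋ f<g g<f+ deep-f deep-g
    with other-end {f} f∋ | other-end {g} g∋
  ... | x , fx | y , gy
    with earlier-edge {g} {d = 2 ^ k} (deep-g y (Joins-∋ʳ {g} gy) 0F) w x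
  ... | e₁ , v₁ , e₁≤ , j₁ , v₁≢w , v₁≢x
    with later-edge {f} {d = 2 ^ k} (deep-f x (Joins-∋ʳ {f} fx) 1F) y v₁
  ... | e₄ , v₅ , e₄≥ , j₄ , v₅≢y , v₅≢v₁ =
    v₁ , y , w , x , v₅ ,
    Joins-≢ {e₁} j₁ ∘ sym , v₁≢w , v₁≢x , v₅≢v₁ ∘ sym , Joins-≢ {g} gy ∘ sym ,
    y≢x , v₅≢y ∘ sym , Joins-≢ {f} fx , w≢v₅ , Joins-≢ {e₄} j₄ ,
    e₁ , g , f , e₄ , Joins-sym {e₁} j₁ , Joins-sym {g} gy , fx , j₄ , e₁<f , f<g , g<e₄
    where
    e₁<f : toℕ e₁ < toℕ f
    e₁<f = +-cancelʳ-< (2 ^ k) (toℕ e₁) (toℕ f) (≤-<-trans e₁≤ g<f+)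

    g<e₄ : toℕ g < toℕ e₄
    g<e₄ = <-≤-trans g<f+ e₄≥

    y≢x : y ≢ x
    y≢x refl = <⇒≢ₚ f<g (Joins-unique {f} {g} fx gy)

    -- Otherwise `e₄` would coincide with `f`; so the two exclusions for `v₅` can be spent on `y`
    -- and `v₁`.
    w≢v₅ : w ≢ v₅
    w≢v₅ refl = <⇒≢ₚ (<-trans f<g g<e₄) (Joins-unique {f} {e₄} fx (Joins-sym {e₄} j₄))

  -- If w has its third edge at time L, the level 3 + k edges of w that fail level 4 + k on side 0F lie in [L + 2ᵏ , L + 2ᵏ⁺¹).
  last-level⇒close : ∀ {w f g} s i → f ∋ w → g ∋ w → toℕ f < toℕ g →
    Level s w i f → Level s w i g → ¬ Level s w (suc i) f → ¬ Level s w (suc i) g →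
    ∃[ k ] i ≡ 3 + k × toℕ g < toℕ f + 2 ^ k
  -- Below level 3, `f` put in front of its own chain takes `g` to the next level; on side 1F `g`
  -- does this for `f`. Level 3 continues the ranks because `2 ^ 0` is 1.
  last-level⇒close {f = f} {g} 0F 0 f∋ _ f<g lf _ _ ¬lg = ⊥-elim (¬lg (f , f∋ , <⇒+1≤ f<g , lf))
  last-level⇒close {f = f} {g} 0F 1 f∋ _ f<g lf _ _ ¬lg = ⊥-elim (¬lg (f , f∋ , <⇒+1≤ f<g , lf))
  last-level⇒close {f = f} {g} 0F 2 f∋ _ f<g lf _ _ ¬lg = ⊥-elim (¬lg (f , f∋ , <⇒+1≤ f<g , lf))
  last-level⇒close {f = f} {g} 1F 0 _ g∋ f<g _ lg ¬lf _ = ⊥-elim (¬lf (g , g∋ , <⇒+1≤ f<g , lg))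
  last-level⇒close {f = f} {g} 1F 1 _ g∋ f<g _ lg ¬lf _ = ⊥-elim (¬lf (g , g∋ , <⇒+1≤ f<g , lg))
  last-level⇒close {f = f} {g} 1F 2 _ g∋ f<g _ lg ¬lf _ = ⊥-elim (¬lf (g , g∋ , <⇒+1≤ f<g , lg))
  -- The chain found for `f` would also serve `g` if `g` were at least `2 ^ suc k` after `q`.
  last-level⇒close {f = f} {g} 0F (suc (suc (suc k))) _ _ _ (q , q∋ , h , c) _ _ ¬lg =
    k , refl , (begin-strict
      toℕ g                     <⟨ ≰⇒> (λ h′ → ¬lg (q , q∋ , h′ , c)) ⟩
      toℕ q + 2 ^ suc k         ≡⟨ a+2b≡a+b+b (toℕ q) (2 ^ k) ⟩
      toℕ q + 2 ^ k + 2 ^ k     ≤⟨ +-monoˡ-≤ (2 ^ k) h ⟩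
      toℕ f + 2 ^ k             ∎)
    where open ≤-Reasoning
  last-level⇒close {f = f} {g} 1F (suc (suc (suc k))) _ _ _ _ (q , q∋ , h , c) ¬lf _ =
    k , refl , +-cancelʳ-< (2 ^ k) _ _ (begin-strict
      toℕ g + 2 ^ k             ≤⟨ h ⟩
      toℕ q                     <⟨ ≰⇒> (λ h′ → ¬lf (q , q∋ , h′ , c)) ⟩
      toℕ f + 2 ^ suc k         ≡⟨ a+2b≡a+b+b (toℕ f) (2 ^ k) ⟩
      toℕ f + 2 ^ k + 2 ^ k     ∎)
    where open ≤-Reasoning

  -- Counting edges by vertex, side and level

  ∣E∣≤n*n : ∣E∣ G ≤ n * n
  ∣E∣≤n*n = injective⇒≤ {f = λ p → combine (proj₁ (ends p)) (proj₂ (ends p))} λ {p} {q} eq →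
    let a , b = combine-injective _ _ _ _ eq in lookup-unique (distinct G) p q (cong₂ _,_ a b)

  module _ (free : ¬ ContainsP5-1324 G) (K : ℕ) (E<2^K : ∣E∣ G < 2 ^ K) where

    -- An edge is charged to a triple (vertex, side, level). `deep` covers the other endpoint too,
    -- because the path is extended there.
    record Class (p : Pos G) : Set where
      constructor class
      field
        vertex : Fin n
        side   : Fin 2
        level  : ℕ
        bound  : level < 3 + K
        ∋v     : p ∋ vertex
        deep   : Deep level p
        fails  : ¬ Level side vertex (suc level) p

    -- `2 ^ K` exceeds the number of edges, so no two edges are that far apart.
    ¬Deep-top : ∀ p → ¬ Deep (3 + K) p
    ¬Deep-top p deep with deep _ (inj₁ refl) 0F
    ... | q , _ , h , _ = <-irrefl refl (begin-strict
      2 ^ K           ≤⟨ m≤n+m _ (toℕ q) ⟩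
      toℕ q + 2 ^ K   ≤⟨ h ⟩
      toℕ p           <⟨ toℕ<n p ⟩
      ∣E∣ G           <⟨ E<2^K ⟩
      2 ^ K           ∎)
      where open ≤-Reasoning

    classify : ∀ p → Class p
    -- Level 0 asks only for empty chains, so the search has a start.
    classify p with last-true (λ i → Deep? i p) (λ _ _ _ → tt) (3 + K) (¬Deep-top p)
    ... | i , i< , deep , ¬deep
      with ¬∀⟶∃¬ n _ (λ w → (p ∋? w) →-dec all? λ s → Level? s w (suc i) p) ¬deep
    ... | w , ¬w with p ∋? w
    ...   | no p∌w = ⊥-elim (¬w (⊥-elim ∘ p∌w))
    ...   | yes p∋w with ¬∀⟶∃¬ 2 _ (λ s → Level? s w (suc i) p) (λ l → ¬w (λ _ → l))
    ...     | s , ¬l = class w s i i< p∋w deep ¬l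

    code : ∀ {p} → Class p → Fin (n * (2 * (3 + K)))
    code c = combine vertex (combine side (fromℕ< bound))
      where open Class c

    same-code⇒⊥ : ∀ {f g} → toℕ f < toℕ g → (c : Class f) (d : Class g) → code c ≢ code d
    same-code⇒⊥ {f} {g} f<g (class w s i i< f∋ deep-f ¬f) (class w′ s′ i′ i<′ g∋ deep-g ¬g) eq
      with combine-injective w (combine s (fromℕ< i<)) w′ (combine s′ (fromℕ< i<′)) eq
    ... | refl , eq′ with combine-injective s (fromℕ< i<) s′ (fromℕ< i<′) eq′
    ... | refl , eq″ with fromℕ<-injective i i′ i< i<′ eq″
    ... | refl
      with last-level⇒close {f = f} {g} s i f∋ g∋ f<g (deep-f w f∋ s) (deep-g w g∋ s) ¬f ¬g
    ... | k , refl , g< = free (close-deep⇒path {f = f} {g} {k} f∋ g∋ f<g g< deep-f deep-g)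

    code-injective : ∀ {f g} (c : Class f) (d : Class g) → code c ≡ code d → f ≡ g
    code-injective {f} {g} c d eq with <-cmp (toℕ f) (toℕ g)
    ... | tri< f<g _ _ = ⊥-elim (same-code⇒⊥ f<g c d eq)
    ... | tri≈ _ f≡g _ = toℕ-injective f≡g
    ... | tri> _ _ g<f = ⊥-elim (same-code⇒⊥ g<f d c (sym eq))

    free⇒∣E∣≤ : ∣E∣ G ≤ n * (2 * (3 + K))
    free⇒∣E∣≤ = injective⇒≤ (λ {f} {g} → code-injective (classify f) (classify g))

-- Binary logarithms

n<2^[1+⌊log₂n⌋] : ∀ n → n < 2 ^ suc ⌊log₂ n ⌋
n<2^[1+⌊log₂n⌋] n = ≰⇒> λ h →
  1+n≰n (subst (_≤ ⌊log₂ n ⌋) (⌊log₂[2^n]⌋≡n (suc ⌊log₂ n ⌋)) (⌊log₂⌋-mono-≤ h))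

k≤⌊log₂n⌋⇒2^k≤n : ∀ k n → 1 ≤ n → k ≤ ⌊log₂ n ⌋ → 2 ^ k ≤ n
k≤⌊log₂n⌋⇒2^k≤n zero    n 1≤n k≤ = 1≤n
k≤⌊log₂n⌋⇒2^k≤n (suc k) (suc (suc n)) 1≤n k≤ = begin
  2 * 2 ^ k                     ≤⟨ *-monoʳ-≤ 2 (k≤⌊log₂n⌋⇒2^k≤n k ⌊ 2 + n /2⌋ (s≤s z≤n) k≤′) ⟩
  2 * ⌊ 2 + n /2⌋               ≡⟨ cong (⌊ 2 + n /2⌋ +_) (+-identityʳ _) ⟩
  ⌊ 2 + n /2⌋ + ⌊ 2 + n /2⌋     ≤⟨ +-monoʳ-≤ ⌊ 2 + n /2⌋ (⌊n/2⌋≤⌈n/2⌉ (2 + n)) ⟩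
  _                             ≡⟨ ⌊n/2⌋+⌈n/2⌉≡n (2 + n) ⟩
  2 + n                         ∎
  where
  open ≤-Reasoning
  k≤′ : k ≤ ⌊log₂ ⌊ 2 + n /2⌋ ⌋
  k≤′ = subst (k ≤_) (sym (⌊log₂⌊n/2⌋⌋≡⌊log₂n⌋∸1 (2 + n))) (∸-monoˡ-≤ 1 k≤)

-- A larger power of two is at least double. Both middle-vertex cases of the lower bound rest on
-- this factor.
2^-gap : ∀ i j → 2 ^ i < 2 ^ j → 2 * 2 ^ i ≤ 2 ^ j
2^-gap i j h = ^-monoʳ-≤ 2 {suc i} {j} (≰⇒> λ j≤i → <⇒≱ h (^-monoʳ-≤ 2 {j} {i} j≤i))

2^-injective : ∀ i j → 2 ^ i ≡ 2 ^ j → i ≡ j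
2^-injective i j eq = trans (sym (⌊log₂[2^n]⌋≡n i)) (trans (cong ⌊log₂_⌋ eq) (⌊log₂[2^n]⌋≡n j))

upper : ∀ n → 8 ≤ n → (G : EOGraph n) → ¬ ContainsP5-1324 G → ∣E∣ G ≤ 14 * (n * ⌊log₂ n ⌋)
upper n 8≤n G free = begin
  -- There are at most n² edges and n < 2^(1 + L), so the scales end at K = 2(1 + L).
  ∣E∣ G                               ≤⟨ free⇒∣E∣≤ free (suc L + suc L) E<2^K ⟩
  n * (2 * (3 + (suc L + suc L)))     ≡⟨ cong (n *_) (expand L) ⟩
  -- 1 ≤ L absorbs the constant term, whence 14 = 4 + 10.
  n * (4 * L + 10 * 1)                ≤⟨ *-monoʳ-≤ n (+-monoʳ-≤ (4 * L) (*-monoʳ-≤ 10 1≤L)) ⟩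
  n * (4 * L + 10 * L)                ≡⟨ collect n L ⟩
  14 * (n * L)                        ∎
  where
  open UpperBound G
  open ≤-Reasoning
  L = ⌊log₂ n ⌋
  1≤L : 1 ≤ L
  1≤L = ≤-trans (s≤s z≤n) (⌊log₂⌋-mono-≤ 8≤n)
  expand : ∀ L → 2 * (3 + (suc L + suc L)) ≡ 4 * L + 10 * 1
  expand = solve-∀
  collect : ∀ n L → n * (4 * L + 10 * L) ≡ 14 * (n * L)
  collect = solve-∀
  E<2^K : ∣E∣ G < 2 ^ (suc L + suc L)
  E<2^K = begin-strict
    ∣E∣ G                     ≤⟨ ∣E∣≤n*n ⟩
    n * n                     <⟨ *-mono-< (n<2^[1+⌊log₂n⌋] n) (n<2^[1+⌊log₂n⌋] n) ⟩
    2 ^ suc L * 2 ^ suc L     ≡⟨ ^-distribˡ-+-* 2 (suc L) (suc L) ⟨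
    2 ^ (suc L + suc L)       ∎

-- The lower bound

-- Low vertices are those below m; the following two lemmas treat a low and a high middle vertex v₃ of the path.

low-middle⇒⊥ : ∀ m v₂ v₃ v₄ v₅ i j l → v₂ ≡ v₃ + m + 2 ^ j → v₄ ≡ v₃ + m + 2 ^ i → v₄ ≡ v₅ + m + 2 ^ l →
  v₂ ≢ v₄ → v₃ + v₄ ≤ v₂ + v₃ → v₂ + v₃ ≤ v₄ + v₅ → ⊥
low-middle⇒⊥ m v₂ v₃ v₄ v₅ i j l refl refl v₄≡ v₂≢v₄ e₃≤e₂ e₂≤e₄ = <⇒≱ v₄+v₅<v₂+v₃ e₂≤e₄
  where
  open ≤-Reasoning
  v₄≤v₂ : v₄ ≤ v₂
  v₄≤v₂ = +-cancelˡ-≤ v₃ v₄ v₂ (subst (v₃ + v₄ ≤_) (+-comm v₂ v₃) e₃≤e₂)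
  2^i<2^j : 2 ^ i < 2 ^ j
  2^i<2^j = +-cancelˡ-< (v₃ + m) (2 ^ i) (2 ^ j) (≤∧≢⇒< v₄≤v₂ (v₂≢v₄ ∘ sym))
  -- `v₃` and `v₅` are both low neighbours of `v₄`, at offsets `2 ^ i` and `2 ^ l`.
  v₅<v₃+2^i : v₅ < v₃ + 2 ^ i
  v₅<v₃+2^i = begin-strict
    v₅             <⟨ m<m+n v₅ (m^n>0 2 l) ⟩
    v₅ + 2 ^ l     ≡⟨ cancel-shift {v₅} {v₃} m (sym v₄≡) ⟩
    v₃ + 2 ^ i     ∎
  regroup : ∀ x m p → x + m + p + (x + p) ≡ x + m + 2 * p + x
  regroup = solve-∀
  v₄+v₅<v₂+v₃ : v₄ + v₅ < v₂ + v₃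
  v₄+v₅<v₂+v₃ = begin-strict
    v₄ + v₅                     <⟨ +-monoʳ-< v₄ v₅<v₃+2^i ⟩
    v₄ + (v₃ + 2 ^ i)           ≡⟨ regroup v₃ m (2 ^ i) ⟩
    v₃ + m + 2 * 2 ^ i + v₃     ≤⟨ +-monoˡ-≤ v₃ (+-monoʳ-≤ (v₃ + m) (2^-gap i j 2^i<2^j)) ⟩
    v₂ + v₃                     ∎

high-middle⇒⊥ : ∀ m v₁ v₂ v₃ v₄ i j l → v₁ ≡ v₂ + m + 2 ^ l → v₃ ≡ v₂ + m + 2 ^ j → v₃ ≡ v₄ + m + 2 ^ i →
  v₂ ≢ v₄ → v₁ + v₂ ≤ v₃ + v₄ → v₃ + v₄ ≤ v₂ + v₃ → ⊥
high-middle⇒⊥ m v₁ v₂ v₃ v₄ i j l refl refl v₃≡ v₂≢v₄ e₁≤e₃ e₃≤e₂ = <⇒≱ v₃+v₄<v₁+v₂ e₁≤e₃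
  where
  open ≤-Reasoning
  v₄<v₂ : v₄ < v₂
  v₄<v₂ = ≤∧≢⇒< (+-cancelˡ-≤ v₃ v₄ v₂ (subst (v₃ + v₄ ≤_) (+-comm v₂ v₃) e₃≤e₂)) (v₂≢v₄ ∘ sym)
  -- Both edges reach the same `v₃`, so the lower start `v₄` needs the larger power.
  2^j<2^i : 2 ^ j < 2 ^ i
  2^j<2^i = ≰⇒> λ 2^i≤2^j → <-irrefl (sym v₃≡) (+-mono-<-≤ (+-monoˡ-< m v₄<v₂) 2^i≤2^j)
  v₄+2^j≤v₂ : v₄ + 2 ^ j ≤ v₂
  v₄+2^j≤v₂ = +-cancelʳ-≤ (2 ^ j) (v₄ + 2 ^ j) v₂ (begin
    v₄ + 2 ^ j + 2 ^ j     ≡⟨ a+2b≡a+b+b v₄ (2 ^ j) ⟨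
    v₄ + 2 * 2 ^ j         ≤⟨ +-monoʳ-≤ v₄ (2^-gap j i 2^j<2^i) ⟩
    v₄ + 2 ^ i             ≡⟨ cancel-shift {v₄} {v₂} m (sym v₃≡) ⟩
    v₂ + 2 ^ j             ∎)
  regroup : ∀ x p y → x + p + y ≡ x + (y + p)
  regroup = solve-∀
  v₃+v₄<v₁+v₂ : v₃ + v₄ < v₁ + v₂
  v₃+v₄<v₁+v₂ = begin-strict
    v₃ + v₄                    ≡⟨ regroup (v₂ + m) (2 ^ j) v₄ ⟩
    v₂ + m + (v₄ + 2 ^ j)      ≤⟨ +-monoʳ-≤ (v₂ + m) v₄+2^j≤v₂ ⟩
    v₂ + m + v₂                <⟨ +-monoˡ-< v₂ (m<m+n (v₂ + m) (m^n>0 2 l)) ⟩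
    v₁ + v₂                    ∎

-- The graph of power-of-two differences and its freeness

module LowerBound (n m K : ℕ) (fits : ∀ (x : Fin m) (k : Fin K) → toℕ x + m + 2 ^ toℕ k < n) where

  low-fits : ∀ (x : Fin m) (k : Fin K) → toℕ x < n
  low-fits x k = ≤-<-trans (≤-trans (m≤m+n (toℕ x) m) (m≤m+n (toℕ x + m) (2 ^ toℕ k))) (fits x k)

  edge : Fin m × Fin K → Fin n × Fin n
  edge (x , k) = fromℕ< (low-fits x k) , fromℕ< (fits x k)

  edge-injective : ∀ {p q} → edge p ≡ edge q → p ≡ q
  edge-injective {x , k} {y , l} eq
    with toℕ-injective (fromℕ<-injective _ _ (low-fits x k) (low-fits y l) (cong proj₁ eq))
  ... | refl = cong (x ,_) (toℕ-injective (2^-injective _ _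
    (+-cancelˡ-≡ (toℕ x + m) _ _ (fromℕ<-injective _ _ (fits x k) (fits x l) (cong proj₂ eq)))))

  indexed-edge : Fin (m * K) → Fin n × Fin n
  indexed-edge i = edge (remQuot K i)

  indexed-edge-injective : ∀ {i j} → indexed-edge i ≡ indexed-edge j → i ≡ j
  indexed-edge-injective {i} {j} eq = trans (sym (combine-remQuot {m} K i))
    (trans (cong (uncurry combine) (edge-injective eq)) (combine-remQuot {m} K j))

  weight : Fin n × Fin n → ℕ
  weight (u , v) = toℕ u + toℕ v

  -- Edges of equal weight are tied and the sort orders them in some way, so positions give only
  -- weak inequalities between weights.
  byWeight : DecTotalOrder _ _ _
  byWeight = On.decTotalOrder ≤-decTotalOrder weight

  open Sort byWeight using (sort; sort-↭; sort-↗)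

  LowHigh : Fin n × Fin n → Set
  LowHigh (u , v) = toℕ u < m × ∃[ k ] toℕ v ≡ toℕ u + m + 2 ^ k

  edge-LowHigh : ∀ p → LowHigh (edge p)
  edge-LowHigh (x , k) =
    subst (_< m) (sym (toℕ-fromℕ< (low-fits x k))) (toℕ<n x) ,
    toℕ k , trans (toℕ-fromℕ< (fits x k)) (cong (λ y → y + m + 2 ^ toℕ k) (sym (toℕ-fromℕ< (low-fits x k))))

  edgeList : List (Fin n × Fin n)
  edgeList = sort (tabulate indexed-edge)

  all-LowHigh : All LowHigh edgeList
  all-LowHigh = All-resp-↭ (↭-sym (sort-↭ _)) (All.tabulate⁺ (λ i → edge-LowHigh (remQuot K i)))

  high : ∀ {u v} → LowHigh (u , v) → ¬ toℕ v < m
  high (_ , k , eq) = ≤⇒≯ (subst (m ≤_) (sym eq) (≤-trans (m≤n+m m _) (m≤m+n _ (2 ^ k))))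

  LowHigh⇒< : ∀ {e} → LowHigh e → toℕ (proj₁ e) < toℕ (proj₂ e)
  LowHigh⇒< lh = <-≤-trans (proj₁ lh) (≮⇒≥ (high lh))

  graph : EOGraph n
  graph = mkEOGraph edgeList (All.map LowHigh⇒< all-LowHigh)
    (Unique-resp-↭ (↭⇒↭ₛ (↭-sym (sort-↭ _))) (Unique.tabulate⁺ indexed-edge-injective))
    where open Permutationₛ (setoid (Fin n × Fin n)) using (Unique-resp-↭)

  ∣E∣-graph : ∣E∣ graph ≡ m * K
  ∣E∣-graph = trans (↭-length (sort-↭ _)) (length-tabulate indexed-edge)

  Joins-weight : ∀ {p u v} → Joins graph p u v → weight (lookup edgeList p) ≡ toℕ u + toℕ v
  Joins-weight (inj₁ eq) = cong weight eq
  Joins-weight {u = u} {v} (inj₂ eq) = trans (cong weight eq) (+-comm (toℕ v) (toℕ u))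

  Joins-mono : ∀ {p q u v u′ v′} → Joins graph p u v → Joins graph q u′ v′ → toℕ p < toℕ q →
    toℕ u + toℕ v ≤ toℕ u′ + toℕ v′
  Joins-mono {p} {q} ju jv p<q = subst₂ _≤_ (Joins-weight {p} ju) (Joins-weight {q} jv)
    (lookup-mono-≤ (DecTotalOrder.totalOrder byWeight) (sort-↗ (tabulate indexed-edge)) (<⇒≤ p<q))

  Joins-LowHigh : ∀ {p u v} → Joins graph p u v → LowHigh (u , v) ⊎ LowHigh (v , u)
  Joins-LowHigh {p} = Sum.map (λ eq → subst LowHigh eq lh) (λ eq → subst LowHigh eq lh)
    where lh = All.lookup all-LowHigh (∈-lookup p)

  low-end : ∀ {p u v} → Joins graph p u v → toℕ u < m → LowHigh (u , v)
  low-end {p} j u<m with Joins-LowHigh {p} j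
  ... | inj₁ lh = lh
  ... | inj₂ lh = ⊥-elim (high lh u<m)

  high-end : ∀ {p u v} → Joins graph p u v → ¬ toℕ u < m → LowHigh (v , u)
  high-end {p} j u≮m with Joins-LowHigh {p} j
  ... | inj₁ (u<m , _) = ⊥-elim (u≮m u<m)
  ... | inj₂ lh = lh

  -- The graph is bipartite, so the side of `v₃` decides all the others. A low `v₃` is refuted by
  -- `e₃`, `e₂`, `e₄`, a high one by `e₁`, `e₃`, `e₂`.
  graph-free : ¬ ContainsP5-1324 graph
  graph-free (v₁ , v₂ , v₃ , v₄ , v₅ , _ , _ , _ , _ , _ , v₂≢v₄ , _ , _ , _ , _ ,
              e₁ , e₂ , e₃ , e₄ , j₁ , j₂ , j₃ , j₄ , e₁<e₃ , e₃<e₂ , e₂<e₄)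
    with e₁≤e₃ ← Joins-mono {e₁} {e₃} j₁ j₃ e₁<e₃
       | e₃≤e₂ ← Joins-mono {e₃} {e₂} j₃ j₂ e₃<e₂
       | e₂≤e₄ ← Joins-mono {e₂} {e₄} j₂ j₄ e₂<e₄
       | toℕ v₃ <? m
  ... | yes low =
    let _ , j , v₂≡  = low-end {e₂} (Sum.swap j₂) low
        e₃-lh        = low-end {e₃} j₃ low
        _ , i , v₄≡  = e₃-lh
        _ , l , v₄≡′ = high-end {e₄} j₄ (high e₃-lh)
    in low-middle⇒⊥ m (toℕ v₂) (toℕ v₃) (toℕ v₄) (toℕ v₅) i j l v₂≡ v₄≡ v₄≡′ (v₂≢v₄ ∘ toℕ-injective) e₃≤e₂ e₂≤e₄
  ... | no ¬low =
    let v₂<m , j , v₃≡ = high-end {e₂} (Sum.swap j₂) ¬low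
        _ , i , v₃≡′   = high-end {e₃} j₃ ¬low
        _ , l , v₁≡    = low-end {e₁} (Sum.swap j₁) v₂<m
    in high-middle⇒⊥ m (toℕ v₁) (toℕ v₂) (toℕ v₃) (toℕ v₄) i j l v₁≡ v₃≡ v₃≡′ (v₂≢v₄ ∘ toℕ-injective) e₁≤e₃ e₃≤e₂

lower : ∀ n → 8 ≤ n → Σ (EOGraph n) λ G → ¬ ContainsP5-1324 G × (n * ⌊log₂ n ⌋ ≤ 24 * ∣E∣ G)
lower n 8≤n = graph , graph-free , (begin
  -- n < 2^(1 + L) = 8 · 2^K and L ≤ 3K give the constant 24.
  n * L                        ≤⟨ *-mono-≤ (<⇒≤ (n<2^[1+⌊log₂n⌋] n)) L≤3K ⟩
  2 ^ suc L * (3 * K)          ≡⟨ cong (λ l → 2 ^ suc l * (3 * K)) (sym 2+K≡L) ⟩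
  2 ^ (3 + K) * (3 * K)        ≡⟨ collect (2 ^ K) K ⟩
  24 * (2 ^ K * K)             ≡⟨ cong (24 *_) ∣E∣-graph ⟨
  24 * ∣E∣ graph               ∎)
  where
  open ≤-Reasoning
  L = ⌊log₂ n ⌋
  -- Three blocks of length 2^K stay below 2^(2 + K) ≤ n, and 8 ≤ n makes K at least 1.
  K = L ∸ 2
  3≤L : 3 ≤ L
  3≤L = ⌊log₂⌋-mono-≤ 8≤n
  2+K≡L : 2 + K ≡ L
  2+K≡L = m+[n∸m]≡n (≤-trans (s≤s (s≤s z≤n)) 3≤L)
  expand : ∀ K → 2 + K ≤ 2 * K + K → 2 + K ≤ 3 * K
  expand K = subst (2 + K ≤_) (+-comm (2 * K) K)
  L≤3K : L ≤ 3 * K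
  L≤3K = subst (_≤ 3 * K) 2+K≡L (expand K (+-monoˡ-≤ K (*-monoʳ-≤ 2 (∸-monoˡ-≤ 2 3≤L))))
  collect : ∀ M K → 2 * (2 * (2 * M)) * (3 * K) ≡ 24 * (M * K)
  collect = solve-∀
  quadruple : ∀ M → M + M + M + M ≡ 2 * (2 * M)
  quadruple = solve-∀
  fits : ∀ (x : Fin (2 ^ K)) (k : Fin K) → toℕ x + 2 ^ K + 2 ^ toℕ k < n
  fits x k = begin-strict
    toℕ x + 2 ^ K + 2 ^ toℕ k         <⟨ +-mono-<-≤ (+-monoˡ-< (2 ^ K) (toℕ<n x)) (^-monoʳ-≤ 2 (<⇒≤ (toℕ<n k))) ⟩
    2 ^ K + 2 ^ K + 2 ^ K             ≤⟨ m≤m+n _ (2 ^ K) ⟩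
    2 ^ K + 2 ^ K + 2 ^ K + 2 ^ K     ≡⟨ quadruple (2 ^ K) ⟩
    2 ^ (2 + K)                       ≤⟨ k≤⌊log₂n⌋⇒2^k≤n (2 + K) n (≤-trans (s≤s z≤n) 8≤n) (≤-reflexive 2+K≡L) ⟩
    n                                 ∎
  open LowerBound n (2 ^ K) K fits

theorem4p14 : Σ ℕ λ a → Σ ℕ λ b → Σ ℕ λ N →
    (1 ≤ a) × (1 ≤ b) ×
    ((n : ℕ) → N ≤ n →
    ((G : EOGraph n) → ¬ ContainsP5-1324 G → ∣E∣ G ≤ b * (n * ⌊log₂ n ⌋))
    × (Σ (EOGraph n) λ G → ¬ ContainsP5-1324 G × (n * ⌊log₂ n ⌋ ≤ a * ∣E∣ G)))
theorem4p14 = 24 , 14 , 8 , s≤s z≤n , s≤s z≤n , λ n 8≤n → upper n 8≤n , lower n 8≤n
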